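{- Let $t \geq 1$ and $k \geq 1$ be integers, and let $\mathcal{F}$ be a finite family of finite sets with $\alpha(\mathcal{F}) \geq t$. Let $\mathcal{A}_1, \dots, \mathcal{A}_k$ be cross-$t$-intersecting sub-families of $\mathcal{F}$ such that $\sum_{i=1}^k |\mathcal{A}_i|$ is maximum among all $k$-tuples of cross-$t$-intersecting sub-families of $\mathcal{F}$. Then: (i) $\sum_{i=1}^k |\mathcal{A}_i| = k\, l(\mathcal{F},t)$ if $k \geq \kappa(\mathcal{F},t)$; (ii) $\sum_{i=1}^k |\mathcal{A}_i| > k\, l(\mathcal{F},t)$ if $k < \kappa(\mathcal{F},t)$.
   Context: All sets and families are finite. A family $\mathcal{A}$ is $t$-intersecting if $|A \cap B| \geq t$ for all $A, B \in \mathcal{A}$ with $A \neq B$. Families $\mathcal{A}_1, \dots, \mathcal{A}_k$ (not necessarily distinct or non-empty) are cross-$t$-intersecting if for all $i \neq j$, $|A \cap B| \geq t$ for every $A \in \mathcal{A}_i$ and $B \in \mathcal{A}_j$. For non-empty $\mathcal{F}$: $\alpha(\mathcal{F}) = \max\{|F| : F \in \mathcal{F}\}$; $l(\mathcal{F},t)$ is the size of a largest $t$-intersecting sub-family of $\mathcal{F}$. For a family $\mathcal{A}$, $\mathcal{A}^{t,+} = \{A \in \mathcal{A} : |A \cap B| \geq t \text{ for all } B \in \mathcal{A}\setminus\{A\}\}$ and $\mathcal{A}^{t,- } = \mathcal{A} \setminus \mathcal{A}^{t,+}$. For $\mathcal{A} \subseteq \mathcal{F}$, $\beta(\mathcal{F},t,\mathcal{A})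 = \frac{l(\mathcal{F},t) - |\mathcal{A}^{t,+}|}{|\mathcal{A}^{t,- }|}$ if $\mathcal{A}^{t,- } \neq \emptyset$, and $\frac{l(\mathcal{F},t)}{|\mathcal{F}|}$ otherwise; $\beta(\mathcal{F},t) = \min_{\mathcal{A} \subseteq \mathcal{F}} \beta(\mathcal{F},t,\mathcal{A})$ and $\kappa(\mathcal{F},t) = 1/\beta(\mathcal{F},t)$. -}

module Defs where

open import Data.Bool.Properties as Bool using ()
open import Data.Fin.Base using (Fin)
open import Data.Fin.Properties as Fin using (all?)
open import Data.Fin.Subset
open import Data.Fin.Subset.Properties
open import Data.Integer.Base as ℤ using (+_; _⊖_)
import Data.Integer.Properties as ℤ
open import Data.List.Base using (List; []; _∷_; [_]; map; _++_; filter; allFin)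
open import Data.List.Extrema.Nat using (max; v≤max⁺)
import Data.List.Extrema
open import Data.List.Membership.Propositional using (lose) renaming (_∈_ to _∈ˡ_)
open import Data.List.Membership.Propositional.Properties
  using (∈-map⁺; ∈-++⁺ˡ; ∈-++⁺ʳ; ∈-filter⁺)
open import Data.List.Relation.Unary.All as All using ()
open import Data.List.Relation.Unary.All.Properties as All using ()
open import Data.List.Relation.Unary.Any using (here)
open import Data.Nat.Base using (ℕ; zero; suc; NonZero; _≤_; _<_; _∸_; >-nonZero; >-nonZero⁻¹)
open import Data.Nat.Properties as ℕ using (_≤?_; +-*-semiring)
open import Data.Product.Base using (_×_; _,_; proj₁; proj₂)
open import Data.Rational.Base as ℚ using (ℚ; _/_; 1/_)
import Data.Rational.Properties as ℚ
open import Data.Sum.Base using (inj₁; inj₂)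
open import Data.Vec.Base using ([]; _∷_; tabulate)
open import Data.Vec.Properties as Vec using ([]=⇒lookup; lookup⇒[]=; lookup∘tabulate)
open import Function.Base using (_∘_; id)
open import Function.Definitions using (Injective)
open import Relation.Binary.PropositionalEquality
  using (_≡_; _≢_; refl; sym; trans; cong; subst)
open import Relation.Nullary
  using (Dec; yes; no; does; ¬?; _→-dec_; _×-dec_; contradiction)
open import Relation.Nullary.Decidable using (dec-true)
open import Relation.Binary.Bundles using (DecTotalOrder)
open import Relation.Unary using (Decidable)

open import Algebra.Properties.Semiring.Sum +-*-semiring public
  using (sum; sum-syntax)

module ℚExtrema = Data.List.Extrema (DecTotalOrder.totalOrder ℚ.≤-decTotalOrder)

-- A finite family of subsets of an n-element ground set, given as an
-- enumeration without repetition, so that `size` is its cardinality.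
record Family (n : ℕ) : Set where
  field
    size      : ℕ
    member    : Fin size → Subset n
    injective : Injective _≡_ _≡_ member

open Family public

-- A sub-family is a set of indices of members; as `member` is injective,
-- ∣ 𝒜 ∣ is its number of members, and `_⊆_`, `_∪_`, … mean what they should.
SubFamily : ∀ {n} → Family n → Set
SubFamily F = Subset (size F)

subsets : ∀ m → List (Subset m)
subsets zero    = [ [] ]
subsets (suc m) = map (inside ∷_) (subsets m) ++ map (outside ∷_) (subsets m)

∈-subsets : ∀ {m} (p : Subset m) → p ∈ˡ subsets m
∈-subsets []            = here refl
∈-subsets (inside  ∷ p) = ∈-++⁺ˡ (∈-map⁺ (inside ∷_) (∈-subsets p))
∈-subsets (outside ∷ p) =
  ∈-++⁺ʳ (map (inside ∷_) (subsets _)) (∈-map⁺ (outside ∷_) (∈-subsets p))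

comprehension : ∀ {m} {P : Fin m → Set} → Decidable P → Subset m
comprehension P? = tabulate (does ∘ P?)

∈-comprehension⁻ : ∀ {m} {P : Fin m → Set} (P? : Decidable P) {i} →
                   i ∈ comprehension P? → P i
∈-comprehension⁻ P? {i} i∈ with P? i | trans (sym (lookup∘tabulate (does ∘ P?) i)) ([]=⇒lookup i∈)
... | yes p | _  = p
... | no _  | ()

∈-comprehension⁺ : ∀ {m} {P : Fin m → Set} (P? : Decidable P) {i} →
                   P i → i ∈ comprehension P?
∈-comprehension⁺ P? {i} p =
  lookup⇒[]= i _ (trans (lookup∘tabulate (does ∘ P?) i) (dec-true (P? i) p))

Nonempty⇒∣∣-nonZero : ∀ {m} {p : Subset m} → Nonempty p → NonZero ∣ p ∣
Nonempty⇒∣∣-nonZero {m} {p} (i , i∈p) = >-nonZero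
  (subst (_≤ ∣ p ∣) (∣⁅x⁆∣≡1 i) (p⊆q⇒∣p∣≤∣q∣ ⁅i⁆⊆p))
  where
  ⁅i⁆⊆p : ⁅ i ⁆ ⊆ p
  ⁅i⁆⊆p x∈ with refl ← x∈⁅y⁆⇒x≡y i x∈ = i∈p

module _ {n : ℕ} (F : Family n) where

  -- The default value 0 of `max` is harmless whenever F is non-empty.
  α : ℕ
  α = max 0 (map (∣_∣ ∘ member F) (allFin (size F)))

  module _ (t : ℕ) where

    Intersecting : SubFamily F → Set
    Intersecting 𝒜 = ∀ i j → i ∈ 𝒜 → j ∈ 𝒜 → member F i ≢ member F j →
                     t ≤ ∣ member F i ∩ member F j ∣

    CrossIntersecting : ∀ {k} → (Fin k → SubFamily F) → Set
    CrossIntersecting 𝒜 = ∀ p q → p ≢ q → ∀ i j → i ∈ 𝒜 p → j ∈ 𝒜 q →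
                          t ≤ ∣ member F i ∩ member F j ∣

    MaximumCrossIntersecting : ∀ {k} → (Fin k → SubFamily F) → Set
    MaximumCrossIntersecting {k} 𝒜 =
      CrossIntersecting 𝒜 ×
      (∀ (ℬ : Fin k → SubFamily F) → CrossIntersecting ℬ →
       ∑[ p < k ] ∣ ℬ p ∣ ≤ ∑[ p < k ] ∣ 𝒜 p ∣)

    private
      _≟_ : ∀ (A B : Subset n) → Dec (A ≡ B)
      _≟_ = Vec.≡-dec Bool._≟_

    intersecting? : Decidable Intersecting
    intersecting? 𝒜 = all? λ i → all? λ j →
      (i ∈? 𝒜) →-dec (j ∈? 𝒜) →-dec ¬? (member F i ≟ member F j) →-dec
      (t ≤? ∣ member F i ∩ member F j ∣)

    -- The empty sub-family is t-intersecting, so the default value 0 is harmless.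
    l : ℕ
    l = max 0 (map ∣_∣ (filter intersecting? (subsets (size F))))

    InPlus : SubFamily F → Fin (size F) → Set
    InPlus 𝒜 i = i ∈ 𝒜 × (∀ j → j ∈ 𝒜 → member F j ≢ member F i →
                          t ≤ ∣ member F i ∩ member F j ∣)

    inPlus? : ∀ 𝒜 → Decidable (InPlus 𝒜)
    inPlus? 𝒜 i = (i ∈? 𝒜) ×-dec all? λ j →
      (j ∈? 𝒜) →-dec ¬? (member F j ≟ member F i) →-dec
      (t ≤? ∣ member F i ∩ member F j ∣)

    infix 8 _⁺ _⁻

    _⁺ : SubFamily F → SubFamily F
    𝒜 ⁺ = comprehension (inPlus? 𝒜)

    _⁻ : SubFamily F → SubFamily F
    𝒜 ⁻ = 𝒜 ─ 𝒜 ⁺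

    module _ .{{_ : NonZero (size F)}} where

      β-at : SubFamily F → ℚ
      β-at 𝒜 with nonempty? (𝒜 ⁻)
      ... | yes 𝒜⁻≢∅ = ((+ l ℤ.- + ∣ 𝒜 ⁺ ∣) / ∣ 𝒜 ⁻ ∣)
                         {{Nonempty⇒∣∣-nonZero 𝒜⁻≢∅}}
      ... | no  _    = + l / size F

      -- The empty sub-family is one of those ranged over, so the default
      -- value of `min` does not change the minimum.
      β : ℚ
      β = ℚExtrema.min (β-at ⊥) (map β-at (subsets (size F)))

    ∣∣≤l : ∀ {𝒜} → Intersecting 𝒜 → ∣ 𝒜 ∣ ≤ l
    ∣∣≤l {𝒜} int = v≤max⁺ 0 _ (inj₂ (lose
      (∈-map⁺ ∣_∣ (∈-filter⁺ intersecting? (∈-subsets 𝒜) int)) ℕ.≤-refl))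

    l-positive : .{{NonZero (size F)}} → 0 < l
    l-positive = go (size F) refl
      where
      go : ∀ m → size F ≡ m → .{{NonZero (size F)}} → 0 < l
      go zero    eq {{nz}} with () ← subst (0 <_) eq (>-nonZero⁻¹ (size F))
      go (suc m) eq = subst (_≤ l) (∣⁅x⁆∣≡1 i) (∣∣≤l {⁅ i ⁆} int)
        where
        i : Fin (size F)
        i = subst Fin (sym eq) Fin.zero
        int : Intersecting ⁅ i ⁆
        int x y x∈ y∈ x≢y = contradiction
          (cong (member F) (trans (x∈⁅y⁆⇒x≡y i x∈) (sym (x∈⁅y⁆⇒x≡y i y∈)))) x≢y

    ∣⁺∣<l : ∀ 𝒜 → Nonempty (𝒜 ⁻) → ∣ 𝒜 ⁺ ∣ < l
    ∣⁺∣<l 𝒜 (x , x∈𝒜⁻) = ℕ.<-≤-trans (p⊂q⇒∣p∣<∣q∣ ⁺⊂) (∣∣≤l {𝒜 ⁺ ∪ ⁅ x ⁆} int)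
      where
      x∈𝒜 : x ∈ 𝒜
      x∈𝒜 = p─q⊆p 𝒜 (𝒜 ⁺) x∈𝒜⁻

      ∈─⇒∉ : ∀ {m} (p q : Subset m) {y} → y ∈ p ─ q → y ∉ q
      ∈─⇒∉ (_ ∷ p) (inside  ∷ q) {Fin.zero}  ()
      ∈─⇒∉ (_ ∷ p) (outside ∷ q) {Fin.zero}  _  ()
      ∈─⇒∉ (_ ∷ p) (_ ∷ q)       {Fin.suc y} y∈ y∈q =
        ∈─⇒∉ p q (drop-there y∈) (drop-there y∈q)

      ⁺⊂ : 𝒜 ⁺ ⊂ 𝒜 ⁺ ∪ ⁅ x ⁆
      ⁺⊂ = p⊆p∪q ⁅ x ⁆ , x , q⊆p∪q (𝒜 ⁺) ⁅ x ⁆ (x∈⁅x⁆ x) , ∈─⇒∉ 𝒜 (𝒜 ⁺) x∈𝒜⁻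

      int : Intersecting (𝒜 ⁺ ∪ ⁅ x ⁆)
      int i j i∈ j∈ i≢j with x∈p∪q⁻ (𝒜 ⁺) ⁅ x ⁆ i∈ | x∈p∪q⁻ (𝒜 ⁺) ⁅ x ⁆ j∈
      ... | inj₁ i∈⁺ | inj₁ j∈⁺ =
        proj₂ (∈-comprehension⁻ (inPlus? 𝒜) i∈⁺) j
          (proj₁ (∈-comprehension⁻ (inPlus? 𝒜) j∈⁺)) (i≢j ∘ sym)
      ... | inj₁ i∈⁺ | inj₂ j∈x with refl ← x∈⁅y⁆⇒x≡y x j∈x =
        proj₂ (∈-comprehension⁻ (inPlus? 𝒜) i∈⁺) x x∈𝒜 (i≢j ∘ sym)
      ... | inj₂ i∈x | inj₁ j∈⁺ with refl ← x∈⁅y⁆⇒x≡y x i∈x =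
        subst (λ p → t ≤ ∣ p ∣) (∩-comm (member F j) (member F x))
          (proj₂ (∈-comprehension⁻ (inPlus? 𝒜) j∈⁺) x x∈𝒜 i≢j)
      ... | inj₂ i∈x | inj₂ j∈x = contradiction
        (cong (member F) (trans (x∈⁅y⁆⇒x≡y x i∈x) (sym (x∈⁅y⁆⇒x≡y x j∈x)))) i≢j

    module _ .{{_ : NonZero (size F)}} where

      β-at-positive : ∀ 𝒜 → ℚ.0ℚ ℚ.< β-at 𝒜
      β-at-positive 𝒜 with nonempty? (𝒜 ⁻)
      ... | yes ne = subst (λ z → ℚ.0ℚ ℚ.< (z / ∣ 𝒜 ⁻ ∣) {{Nonempty⇒∣∣-nonZero ne}})
        (sym (trans (ℤ.m-n≡m⊖n l ∣ 𝒜 ⁺ ∣) (ℤ.⊖-≥ (ℕ.<⇒≤ lt))))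
        (ℚ.positive⁻¹ _ {{ℚ.normalize-pos (l ∸ ∣ 𝒜 ⁺ ∣) ∣ 𝒜 ⁻ ∣
          {{Nonempty⇒∣∣-nonZero ne}} {{>-nonZero (ℕ.m<n⇒0<n∸m lt)}}}})
        where
        lt : ∣ 𝒜 ⁺ ∣ < l
        lt = ∣⁺∣<l 𝒜 ne
      ... | no _ = ℚ.positive⁻¹ _ {{ℚ.normalize-pos l (size F)}}
        where
        instance
          l-nonZero : NonZero l
          l-nonZero = >-nonZero l-positive

      β-positive : ℚ.0ℚ ℚ.< β
      β-positive = ℚExtrema.argmin-all id {P = ℚ.0ℚ ℚ.<_}
        (β-at-positive ⊥)
        (All.map⁺ {xs = subsets (size F)} (All.tabulate λ {𝒜} _ → β-at-positive 𝒜))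

      κ : ℚ
      κ = (1/ β) {{ℚ.>-nonZero β-positive}}

{-# OPTIONS --safe #-}
module Submission where

-- Let 𝒰 be the union of a cross-t-intersecting tuple 𝒜₁, …, 𝒜ₖ.  A set lying in
-- two of the 𝒜ᵢ belongs to 𝒰⁺, so ∑ ∣𝒜ᵢ∣ ≤ k∣𝒰⁺∣ + ∣𝒰⁻∣, and kβ ≥ 1 bounds this
-- by k∣𝒰⁺∣ + k(l − ∣𝒰⁺∣) = kl; k copies of a largest t-intersecting sub-family
-- attain kl.  If kβ < 1 and β is attained at ℬ, then (ℬ, ℬ⁺, …, ℬ⁺) is
-- cross-t-intersecting with sum k∣ℬ⁺∣ + ∣ℬ⁻∣ > kl when ℬ⁻ ≠ ∅, and
-- (ℱ, ∅, …, ∅) has sum ∣ℱ∣ > kl when ℬ⁻ = ∅.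

open import Defs
open import Algebra.Properties.CommutativeSemigroup
  using () renaming (interchange to ∙-interchange; xy∙z≈xz∙y to [x∙y]∙z≈[x∙z]∙y)
open import Data.Fin.Base using (Fin; zero; suc)
open import Data.Fin.Properties using (any?; suc-injective) renaming (_≟_ to _≟ᶠ_)
open import Data.Fin.Subset
  using (Subset; inside; outside; Nonempty; _∈_; _⊆_; _∩_; _─_; ⊥; ⊤; ⁅_⁆; ∣_∣)
open import Data.Fin.Subset.Properties
open import Data.Integer.Base as ℤ using (+_)
import Data.Integer.Properties as ℤ
open import Data.List.Base using (map; filter; allFin)
open import Data.List.Extrema.Nat using (max; argmax-sel)
open import Data.List.Membership.Propositional using () renaming (_∈_ to _∈ˡ_)
open import Data.List.Membership.Propositional.Properties using (∈-map⁺; ∈-map⁻; ∈-filter⁻)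
import Data.List.Relation.Unary.All as All
open import Data.Nat.Base using (ℕ; NonZero; _≤_; _<_; _≥_; _>_; _+_; _*_; _∸_; z≤n)
import Data.Nat.Properties as ℕ
open import Data.Product.Base using (_×_; ∃; ∃-syntax; _,_; proj₁; proj₂)
open import Data.Rational.Base as ℚ using (ℚ; _/_)
import Data.Rational.Properties as ℚ
open import Data.Rational.Unnormalised.Base as ℚᵘ using (mkℚᵘ)
import Data.Rational.Unnormalised.Properties as ℚᵘ
open import Data.Sum.Base using (_⊎_; inj₁; inj₂)
open import Data.Vec.Base using ([]; _∷_)
import Data.Vec.Functional as Vector
open import Function.Base using (_∘_; id)
open import Relation.Binary.PropositionalEquality
  using (_≡_; _≢_; refl; sym; trans; cong; subst)
open import Relation.Nullary using (Dec; ¬_; yes; no; contradiction; _×-dec_)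

-- Counting elements over tuples of subsets.

sum-const : ∀ k (c : ℕ) → ∑[ i < k ] c ≡ k * c
sum-const ℕ.zero    c = refl
sum-const (ℕ.suc k) c = cong (λ s → c + s) (sum-const k c)

∣p∩q∣+∣p─q∣≡∣p∣ : ∀ {m} (p q : Subset m) → ∣ p ∩ q ∣ + ∣ p ─ q ∣ ≡ ∣ p ∣
∣p∩q∣+∣p─q∣≡∣p∣ []            []            = refl
∣p∩q∣+∣p─q∣≡∣p∣ (outside ∷ p) (outside ∷ q) = ∣p∩q∣+∣p─q∣≡∣p∣ p q
∣p∩q∣+∣p─q∣≡∣p∣ (outside ∷ p) (inside  ∷ q) = ∣p∩q∣+∣p─q∣≡∣p∣ p q
∣p∩q∣+∣p─q∣≡∣p∣ (inside  ∷ p) (inside  ∷ q) = cong ℕ.suc (∣p∩q∣+∣p─q∣≡∣p∣ p q)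
∣p∩q∣+∣p─q∣≡∣p∣ (inside  ∷ p) (outside ∷ q) =
  trans (ℕ.+-suc ∣ p ∩ q ∣ _) (cong ℕ.suc (∣p∩q∣+∣p─q∣≡∣p∣ p q))

-- Otherwise removing `q` a second time would strictly shrink `p ─ q`, although set difference is
-- idempotent.
x∈p─q⇒x∉q : ∀ {m} (p q : Subset m) {x} → x ∈ p ─ q → ¬ x ∈ q
x∈p─q⇒x∉q p q {x} x∈p─q x∈q =
  ℕ.<-irrefl refl (subst (λ r → ∣ r ∣ < ∣ p ─ q ∣) (p─q─q≡p─q p q)
    (p∩q≢∅⇒∣p─q∣<∣p∣ (p ─ q) q (x , x∈p∩q⁺ (x∈p─q , x∈q))))

-- Each `𝒜 p` has at most `∣ P ∣` elements in `P`; the parts outside `P` are pairwise disjoint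
-- subsets of `M`. The induction spends `M ∩ A` on the first set and leaves `M ─ A` for the others.
∑∣∣≤k∣P∣+∣M∣ : ∀ {k m} (𝒜 : Fin k → Subset m) (P M : Subset m) →
               (∀ p {x} → x ∈ 𝒜 p → ¬ x ∈ P → x ∈ M) →
               (∀ p q → p ≢ q → ∀ {x} → x ∈ 𝒜 p → x ∈ 𝒜 q → x ∈ P) →
               ∑[ p < k ] ∣ 𝒜 p ∣ ≤ k * ∣ P ∣ + ∣ M ∣
∑∣∣≤k∣P∣+∣M∣ {ℕ.zero}  𝒜 P M cover shared = z≤n
∑∣∣≤k∣P∣+∣M∣ {ℕ.suc k} 𝒜 P M cover shared = begin
  ∣ A ∣ + ∑[ p < k ] ∣ 𝒜 (suc p) ∣
    ≤⟨ ℕ.+-mono-≤ ∣A∣≤ (∑∣∣≤k∣P∣+∣M∣ (𝒜 ∘ suc) P (M ─ A) cover′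
         (λ p q p≢q → shared (suc p) (suc q) (p≢q ∘ suc-injective))) ⟩
  (∣ P ∣ + ∣ M ∩ A ∣) + (k * ∣ P ∣ + ∣ M ─ A ∣)
    ≡⟨ ∙-interchange ℕ.+-commutativeSemigroup ∣ P ∣ _ _ _ ⟩
  (∣ P ∣ + k * ∣ P ∣) + (∣ M ∩ A ∣ + ∣ M ─ A ∣)
    ≡⟨ cong (λ s → ∣ P ∣ + k * ∣ P ∣ + s) (∣p∩q∣+∣p─q∣≡∣p∣ M A) ⟩
  (∣ P ∣ + k * ∣ P ∣) + ∣ M ∣ ∎
  where
  open ℕ.≤-Reasoning
  A : Subset _
  A = 𝒜 zero

  A─P⊆M∩A : A ─ P ⊆ M ∩ A
  A─P⊆M∩A x∈ = x∈p∩q⁺ (cover zero (p─q⊆p A P x∈) (x∈p─q⇒x∉q A P x∈) , p─q⊆p A P x∈)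

  ∣A∣≤ : ∣ A ∣ ≤ ∣ P ∣ + ∣ M ∩ A ∣
  ∣A∣≤ = ℕ.≤-trans (ℕ.≤-reflexive (sym (∣p∩q∣+∣p─q∣≡∣p∣ A P)))
    (ℕ.+-mono-≤ (∣p∩q∣≤∣q∣ A P) (p⊆q⇒∣p∣≤∣q∣ A─P⊆M∩A))

  cover′ : ∀ p {x} → x ∈ 𝒜 (suc p) → ¬ x ∈ P → x ∈ M ─ A
  cover′ p x∈ x∉P = x∈p∧x∉q⇒x∈p─q (cover (suc p) x∈ x∉P)
    λ x∈A → x∉P (shared (suc p) zero (λ ()) x∈ x∈A)

-- Clearing denominators in comparisons with 1.

-- Unnormalised fractions keep `m` and the denominator free of gcds, so a comparison unfolds to an
-- integer inequality.
toℚᵘ-k*m/b : ∀ k m b → ℚ.toℚᵘ ((+ k / 1) ℚ.* (+ m / ℕ.suc b)) ℚᵘ.≃ mkℚᵘ (+ k) 0 ℚᵘ.* mkℚᵘ (+ m) b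
toℚᵘ-k*m/b k m b = ℚᵘ.≃-trans (ℚ.toℚᵘ-homo-* (+ k / 1) (+ m / ℕ.suc b))
  (ℚᵘ.*-cong (ℚ.toℚᵘ-fromℚᵘ (mkℚᵘ (+ k) 0)) (ℚ.toℚᵘ-fromℚᵘ (mkℚᵘ (+ m) b)))

1≤k*m/b⇒b≤k*m : ∀ k m b .{{_ : NonZero b}} →
                ℚ.1ℚ ℚ.≤ (+ k / 1) ℚ.* (+ m / b) → b ≤ k * m
1≤k*m/b⇒b≤k*m k m (ℕ.suc b) le
  with ℚᵘ.*≤* le′ ← ℚᵘ.≤-respʳ-≃ (toℚᵘ-k*m/b k m b) (ℚ.toℚᵘ-mono-≤ le)
  -- One `+ 0` comes from multiplying the denominators, the other from cross-multiplying by 1.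
  rewrite ℤ.*-identityʳ (+ k ℤ.* + m) | sym (ℤ.pos-* k m) | ℕ.+-identityʳ b | ℕ.+-identityʳ b
  = ℤ.drop‿+≤+ le′

k*m/b<1⇒k*m<b : ∀ k m b .{{_ : NonZero b}} →
                (+ k / 1) ℚ.* (+ m / b) ℚ.< ℚ.1ℚ → k * m < b
k*m/b<1⇒k*m<b k m (ℕ.suc b) lt
  with ℚᵘ.*<* lt′ ← ℚᵘ.<-respˡ-≃ (toℚᵘ-k*m/b k m b) (ℚ.toℚᵘ-mono-< lt)
  rewrite ℤ.*-identityʳ (+ k ℤ.* + m) | sym (ℤ.pos-* k m) | ℕ.+-identityʳ b | ℕ.+-identityʳ b
  = ℤ.drop‿+<+ lt′

[m-n]/d≡[m∸n]/d : ∀ m n d .{{_ : NonZero d}} → n ≤ m →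
                  (+ m ℤ.- + n) / d ≡ + (m ∸ n) / d
[m-n]/d≡[m∸n]/d m n d n≤m = cong (λ z → z / d) (trans (ℤ.m-n≡m⊖n m n) (ℤ.⊖-≥ n≤m))

max-attained : ∀ {A : Set} (f : A → ℕ) xs →
               max 0 (map f xs) ≡ 0 ⊎ ∃[ x ] x ∈ˡ xs × max 0 (map f xs) ≡ f x
max-attained f xs with argmax-sel id 0 (map f xs)
... | inj₁ eq = inj₁ eq
... | inj₂ ∈m with x , x∈ , eq ← ∈-map⁻ f ∈m = inj₂ (x , x∈ , eq)

-- Members meeting in `t` elements, and the plus and minus parts.

module _ {n : ℕ} (F : Family n) (t : ℕ) where

  Meet : Fin (size F) → Fin (size F) → Set
  Meet i j = t ≤ ∣ member F i ∩ member F j ∣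

  -- Equal indices are included, so unlike `Intersecting`, `AllMeet X X` forces every member of `X`
  -- to have at least `t` elements. Copies of `X` in different slots of a tuple require this.
  AllMeet : SubFamily F → SubFamily F → Set
  AllMeet X Y = ∀ {i j} → i ∈ X → j ∈ Y → Meet i j

  Meet-sym : ∀ {i j} → Meet i j → Meet j i
  Meet-sym {i} {j} = subst (λ p → t ≤ ∣ p ∣) (∩-comm (member F i) (member F j))

  Meet⇒self : ∀ {i j} → Meet i j → Meet i i
  Meet⇒self {i} {j} m = subst (λ p → t ≤ ∣ p ∣) (sym (∩-idem (member F i)))
    (ℕ.≤-trans m (∣p∩q∣≤∣p∣ (member F i) (member F j)))

  module _ (𝒜 : SubFamily F) where

    ⁺⊆ : _⁺ F t 𝒜 ⊆ 𝒜
    ⁺⊆ = proj₁ ∘ ∈-comprehension⁻ (inPlus? F t 𝒜)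

    ⁺-meet : ∀ {i j} → i ∈ _⁺ F t 𝒜 → j ∈ 𝒜 → i ≢ j → Meet i j
    ⁺-meet i∈ j∈ i≢j = proj₂ (∈-comprehension⁻ (inPlus? F t 𝒜) i∈) _ j∈
      (i≢j ∘ sym ∘ injective F)

    ⁺-intersecting : Intersecting F t (_⁺ F t 𝒜)
    ⁺-intersecting i j i∈ j∈ Mi≢Mj = ⁺-meet i∈ (⁺⊆ j∈) (Mi≢Mj ∘ cong (member F))

    ∣⁺∣+∣⁻∣≤∣𝒜∣ : ∣ _⁺ F t 𝒜 ∣ + ∣ _⁻ F t 𝒜 ∣ ≤ ∣ 𝒜 ∣
    ∣⁺∣+∣⁻∣≤∣𝒜∣ = subst (∣ _⁺ F t 𝒜 ∣ + ∣ _⁻ F t 𝒜 ∣ ≤_) (∣p∩q∣+∣p─q∣≡∣p∣ 𝒜 (_⁺ F t 𝒜))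
      (ℕ.+-monoˡ-≤ _ (p⊆q⇒∣p∣≤∣q∣ λ x∈ → x∈p∩q⁺ (⁺⊆ x∈ , x∈)))

    -- A member of 𝒜⁺ smaller than t would be isolated in 𝒜, but it meets
    -- every element of 𝒜⁻.
    ⁺-meet-all : Nonempty (_⁻ F t 𝒜) → AllMeet (_⁺ F t 𝒜) 𝒜
    ⁺-meet-all (x , x∈⁻) {i} {j} i∈ j∈ with i ≟ᶠ j
    ... | no i≢j   = ⁺-meet i∈ j∈ i≢j
    ... | yes refl = Meet⇒self {i} {x} (⁺-meet i∈ (p─q⊆p 𝒜 _ x∈⁻)
      λ { refl → x∈p─q⇒x∉q 𝒜 (_⁺ F t 𝒜) x∈⁻ i∈ })

    -- Truncated subtraction loses nothing: `𝒜⁺` is t-intersecting, hence no larger than `l`.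
    k∣⁺∣+k[l∸∣⁺∣] : ∀ k → k * ∣ _⁺ F t 𝒜 ∣ + k * (l F t ∸ ∣ _⁺ F t 𝒜 ∣) ≡ k * l F t
    k∣⁺∣+k[l∸∣⁺∣] k = trans (sym (ℕ.*-distribˡ-+ k ∣ _⁺ F t 𝒜 ∣ _))
      (cong (k *_) (ℕ.m+[n∸m]≡n (∣∣≤l F t {_⁺ F t 𝒜} ⁺-intersecting)))

  -- Bounds on the sum over a cross-intersecting tuple.

  ∑≤k∣⋃⁺∣+∣⋃⁻∣ : ∀ {k} (𝒜 : Fin k → SubFamily F) → CrossIntersecting F t 𝒜 →
    ∃[ 𝒰 ] ∑[ p < k ] ∣ 𝒜 p ∣ ≤ k * ∣ _⁺ F t 𝒰 ∣ + ∣ _⁻ F t 𝒰 ∣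
  ∑≤k∣⋃⁺∣+∣⋃⁻∣ {k} 𝒜 cross = 𝒰 , ∑∣∣≤k∣P∣+∣M∣ 𝒜 (_⁺ F t 𝒰) (_⁻ F t 𝒰)
      (λ p x∈ x∉ → x∈p∧x∉q⇒x∈p─q (∈-comprehension⁺ ∈⋃? (p , x∈)) x∉) shared
    where
    ∈⋃? = λ i → any? λ p → i ∈? 𝒜 p
    𝒰 : SubFamily F
    𝒰 = comprehension ∈⋃?

    shared : ∀ p q → p ≢ q → ∀ {x} → x ∈ 𝒜 p → x ∈ 𝒜 q → x ∈ _⁺ F t 𝒰
    shared p q p≢q {x} x∈p x∈q = ∈-comprehension⁺ (inPlus? F t 𝒰)
      (∈-comprehension⁺ ∈⋃? (p , x∈p) , λ j j∈ _ → meets j (∈-comprehension⁻ ∈⋃? j∈))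
      where
      meets : ∀ j → ∃ (λ r → j ∈ 𝒜 r) → Meet x j
      -- As `p ≢ q`, at least one of the two slots holding `x` differs from the slot `r` of `j`.
      meets j (r , j∈r) with p ≟ᶠ r
      ... | no  p≢r  = cross p r p≢r x j x∈p j∈r
      ... | yes refl = cross q p (p≢q ∘ sym) x j x∈q j∈r

  -- Two copies of `Y` meet because one of them can be viewed inside `X`.
  ∷-replicate-cross : ∀ {k} {X Y : SubFamily F} → Y ⊆ X →
    AllMeet Y X →
    CrossIntersecting F t (X Vector.∷ Vector.replicate k Y)
  ∷-replicate-cross Y⊆X meets zero    zero    p≢q i j i∈ j∈ = contradiction refl p≢q
  ∷-replicate-cross Y⊆X meets zero    (suc _) p≢q i j i∈ j∈ = Meet-sym {j} {i} (meets j∈ i∈)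
  ∷-replicate-cross Y⊆X meets (suc _) zero    p≢q i j i∈ j∈ = meets i∈ j∈
  ∷-replicate-cross Y⊆X meets (suc _) (suc _) p≢q i j i∈ j∈ = meets i∈ (Y⊆X j∈)

  -- Every lower bound on the maximum comes from here, with `(X , Y)` being `(ℬ , ℬ⁺)`, `(⊤ , ⊥)` or
  -- `(ℒ , ℒ)`.
  ∷-replicate-≤ : ∀ {k} {X Y : SubFamily F} {𝒜 : Fin (ℕ.suc k) → SubFamily F} →
    MaximumCrossIntersecting F t 𝒜 → Y ⊆ X →
    AllMeet Y X →
    ∣ X ∣ + k * ∣ Y ∣ ≤ ∑[ p < ℕ.suc k ] ∣ 𝒜 p ∣
  ∷-replicate-≤ {k} {X} {Y} {𝒜} (_ , maximum) Y⊆X meets =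
    subst (λ s → ∣ X ∣ + s ≤ _) (sum-const k ∣ Y ∣)
      (maximum (X Vector.∷ Vector.replicate k Y) (∷-replicate-cross {k} {X} {Y} Y⊆X meets))

  -- A t-intersecting sub-family with a member smaller than t has no other
  -- member, and can be replaced by a single set of size at least t.
  largest-meeting : t ≥ 1 → α F ≥ t →
    ∃[ ℒ ] l F t ≤ ∣ ℒ ∣ × AllMeet ℒ ℒ
  largest-meeting t≥1 α≥t with max-attained ∣_∣ (filter (intersecting? F t) (subsets (size F)))
  ... | inj₁ l≡0 = ⊥ , subst (_≤ _) (sym l≡0) z≤n , λ i∈ → contradiction i∈ ∉⊥
  ... | inj₂ (ℒ , ℒ∈ , l≡) = go (any? λ i → (i ∈? ℒ) ×-dec (∣ member F i ∩ member F i ∣ ℕ.<? t))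
    where
    intersecting : Intersecting F t ℒ
    intersecting = proj₂ (∈-filter⁻ (intersecting? F t) {xs = subsets (size F)} ℒ∈)

    meet-distinct : ∀ {i j} → i ∈ ℒ → j ∈ ℒ → i ≢ j → Meet i j
    meet-distinct i∈ j∈ i≢j = intersecting _ _ i∈ j∈ (i≢j ∘ injective F)

    large : ∃ λ h → Meet h h
    large with max-attained (∣_∣ ∘ member F) (allFin (size F))
    -- The default 0 of `max` is excluded by `1 ≤ t ≤ α F`, so the maximum is the size of some
    -- member.
    ... | inj₁ α≡0 = contradiction (ℕ.≤-trans t≥1 (subst (t ≤_) α≡0 α≥t)) λ ()
    ... | inj₂ (h , _ , α≡) = h , subst (λ p → t ≤ ∣ p ∣) (sym (∩-idem (member F h))) (subst (t ≤_) α≡ α≥t)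

    go : Dec (∃[ i ] i ∈ ℒ × ∣ member F i ∩ member F i ∣ < t) →
         ∃[ ℳ ] l F t ≤ ∣ ℳ ∣ × AllMeet ℳ ℳ
    go (no ¬small) = ℒ , ℕ.≤-reflexive l≡ , meets
      where
      meets : AllMeet ℒ ℒ
      meets {i} {j} i∈ j∈ with i ≟ᶠ j
      ... | no i≢j   = meet-distinct i∈ j∈ i≢j
      ... | yes refl = ℕ.≮⇒≥ λ small → ¬small (i , i∈ , small)
    go (yes (i , i∈ , small)) = ⁅ proj₁ large ⁆ , l≤1 , meets
      where
      ℒ⊆⁅i⁆ : ℒ ⊆ ⁅ i ⁆
      ℒ⊆⁅i⁆ {j} j∈ with i ≟ᶠ j
      ... | yes refl = x∈⁅x⁆ i
      ... | no i≢j   = contradiction (Meet⇒self {i} {j} (meet-distinct i∈ j∈ i≢j)) (ℕ.<⇒≱ small)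

      l≤1 : l F t ≤ ∣ ⁅ proj₁ large ⁆ ∣
      l≤1 = ℕ.≤-trans (ℕ.≤-reflexive l≡) (ℕ.≤-trans (p⊆q⇒∣p∣≤∣q∣ ℒ⊆⁅i⁆)
        (ℕ.≤-reflexive (trans (∣⁅x⁆∣≡1 i) (sym (∣⁅x⁆∣≡1 (proj₁ large))))))

      meets : AllMeet ⁅ proj₁ large ⁆ ⁅ proj₁ large ⁆
      meets i∈ j∈ with refl ← x∈⁅y⁆⇒x≡y (proj₁ large) i∈ | refl ← x∈⁅y⁆⇒x≡y (proj₁ large) j∈ =
        proj₂ large

  -- From `β` and `κ` to inequalities between natural numbers.

  module _ .{{_ : NonZero (size F)}} where

    β≤β-at : ∀ 𝒜 → β F t ℚ.≤ β-at F t 𝒜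
    β≤β-at 𝒜 = All.lookup (ℚExtrema.min≤xs (β-at F t ⊥) (map (β-at F t) (subsets (size F))))
      (∈-map⁺ (β-at F t) (∈-subsets 𝒜))

    β-attained : ∃[ 𝒜 ] β F t ≡ β-at F t 𝒜
    β-attained with ℚExtrema.argmin-sel id (β-at F t ⊥) (map (β-at F t) (subsets (size F)))
    ... | inj₁ eq = ⊥ , eq
    ... | inj₂ ∈m with 𝒜 , _ , eq ← ∈-map⁻ (β-at F t) ∈m = 𝒜 , eq

    private
      instance
        β-pos : ℚ.Positive (β F t)
        β-pos = ℚ.positive (β-positive F t)

    κβ≡1 : κ F t ℚ.* β F t ≡ ℚ.1ℚ
    κβ≡1 = ℚ.*-inverseˡ (β F t) {{ℚ.>-nonZero (β-positive F t)}}

    κ≤q⇒1≤qβ : ∀ q → κ F t ℚ.≤ q → ℚ.1ℚ ℚ.≤ q ℚ.* β F t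
    κ≤q⇒1≤qβ q κ≤q = subst (ℚ._≤ q ℚ.* β F t) κβ≡1
      (ℚ.*-monoʳ-≤-nonNeg (β F t) {{ℚ.pos⇒nonNeg (β F t)}} κ≤q)

    q<κ⇒qβ<1 : ∀ q → q ℚ.< κ F t → q ℚ.* β F t ℚ.< ℚ.1ℚ
    q<κ⇒qβ<1 q q<κ = subst (q ℚ.* β F t ℚ.<_) κβ≡1 (ℚ.*-monoˡ-<-pos (β F t) q<κ)

    -- With the value as an index, matching turns `β-at`, or `β` itself at a minimiser, into an
    -- explicit fraction. Its numerator is a natural number, as clearing denominators requires.
    data β-View (𝒜 : SubFamily F) : ℚ → Set where
      ⁻-nonempty : (ne : Nonempty (_⁻ F t 𝒜)) →
        β-View 𝒜 ((+ (l F t ∸ ∣ _⁺ F t 𝒜 ∣) / ∣ _⁻ F t 𝒜 ∣) {{Nonempty⇒∣∣-nonZero ne}})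
      ⁻-empty    : ¬ Nonempty (_⁻ F t 𝒜) → β-View 𝒜 (+ l F t / size F)

    β-view : ∀ 𝒜 → β-View 𝒜 (β-at F t 𝒜)
    β-view 𝒜 with nonempty? (_⁻ F t 𝒜)
    ... | yes ne   = subst (β-View 𝒜)
      (sym ([m-n]/d≡[m∸n]/d (l F t) ∣ _⁺ F t 𝒜 ∣ ∣ _⁻ F t 𝒜 ∣ {{Nonempty⇒∣∣-nonZero ne}}
        (∣∣≤l F t {_⁺ F t 𝒜} (⁺-intersecting 𝒜))))
      (⁻-nonempty ne)
    ... | no empty = ⁻-empty empty

    1≤kβ⇒k∣⁺∣+∣⁻∣≤kl : ∀ k {𝒜 q} → β-View 𝒜 q → ℚ.1ℚ ℚ.≤ (+ k / 1) ℚ.* q →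
      k * ∣ _⁺ F t 𝒜 ∣ + ∣ _⁻ F t 𝒜 ∣ ≤ k * l F t
    1≤kβ⇒k∣⁺∣+∣⁻∣≤kl k {𝒜} (⁻-nonempty ne) 1≤kβ = ℕ.≤-trans
      (ℕ.+-monoʳ-≤ (k * ∣ _⁺ F t 𝒜 ∣)
        (1≤k*m/b⇒b≤k*m k (l F t ∸ ∣ _⁺ F t 𝒜 ∣) ∣ _⁻ F t 𝒜 ∣ {{Nonempty⇒∣∣-nonZero ne}} 1≤kβ))
      (ℕ.≤-reflexive (k∣⁺∣+k[l∸∣⁺∣] 𝒜 k))
    1≤kβ⇒k∣⁺∣+∣⁻∣≤kl k {𝒜} (⁻-empty empty) _ = begin
      k * p + ∣ _⁻ F t 𝒜 ∣     ≡⟨ cong (λ s → k * p + ∣ s ∣) (Empty-unique empty) ⟩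
      k * p + ∣ ⊥ {size F} ∣   ≡⟨ cong (λ s → k * p + s) (∣⊥∣≡0 (size F)) ⟩
      k * p + 0                ≡⟨ ℕ.+-identityʳ (k * p) ⟩
      k * p                    ≤⟨ ℕ.*-monoʳ-≤ k (∣∣≤l F t {_⁺ F t 𝒜} (⁺-intersecting 𝒜)) ⟩
      k * l F t                ∎
      where
      open ℕ.≤-Reasoning
      p : ℕ
      p = ∣ _⁺ F t 𝒜 ∣

    kβ<1⇒kl<∑ : ∀ k {ℬ q} → β-View ℬ q → (+ ℕ.suc k / 1) ℚ.* q ℚ.< ℚ.1ℚ →
      (𝒜 : Fin (ℕ.suc k) → SubFamily F) → MaximumCrossIntersecting F t 𝒜 →
      ℕ.suc k * l F t < ∑[ p < ℕ.suc k ] ∣ 𝒜 p ∣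
    kβ<1⇒kl<∑ k {ℬ} (⁻-nonempty ne) kβ<1 𝒜 maximum = begin-strict
      ℕ.suc k * l F t                      ≡⟨ k∣⁺∣+k[l∸∣⁺∣] ℬ (ℕ.suc k) ⟨
      ℕ.suc k * p + ℕ.suc k * (l F t ∸ p)  <⟨ ℕ.+-monoʳ-< (ℕ.suc k * p)
        (k*m/b<1⇒k*m<b (ℕ.suc k) (l F t ∸ p) m {{Nonempty⇒∣∣-nonZero ne}} kβ<1) ⟩
      -- One of the `suc k` copies of `ℬ⁺` joins `ℬ⁻` to fill the first slot with `ℬ`; the other `k`
      -- form the tail of the tuple.
      (p + k * p) + m                      ≡⟨ [x∙y]∙z≈[x∙z]∙y ℕ.+-commutativeSemigroup p (k * p) m ⟩
      (p + m) + k * p                      ≤⟨ ℕ.+-monoˡ-≤ (k * p) (∣⁺∣+∣⁻∣≤∣𝒜∣ ℬ) ⟩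
      ∣ ℬ ∣ + k * p
        ≤⟨ ∷-replicate-≤ {X = ℬ} {Y = _⁺ F t ℬ} {𝒜 = 𝒜} maximum (⁺⊆ ℬ) (⁺-meet-all ℬ ne) ⟩
      ∑[ q < ℕ.suc k ] ∣ 𝒜 q ∣             ∎
      where
      open ℕ.≤-Reasoning
      p m : ℕ
      p = ∣ _⁺ F t ℬ ∣
      m = ∣ _⁻ F t ℬ ∣
    kβ<1⇒kl<∑ k (⁻-empty _) kβ<1 𝒜 maximum = begin-strict
      ℕ.suc k * l F t                      <⟨ k*m/b<1⇒k*m<b (ℕ.suc k) (l F t) (size F) kβ<1 ⟩
      size F                               ≡⟨ ∣⊤∣≡n (size F) ⟨
      ∣ ⊤ {size F} ∣                       ≤⟨ ℕ.m≤m+n _ (k * ∣ ⊥ {size F} ∣) ⟩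
      ∣ ⊤ {size F} ∣ + k * ∣ ⊥ {size F} ∣
        ≤⟨ ∷-replicate-≤ {X = ⊤} {Y = ⊥} {𝒜 = 𝒜} maximum (λ _ → ∈⊤) (λ i∈⊥ → contradiction i∈⊥ ∉⊥) ⟩
      ∑[ q < ℕ.suc k ] ∣ 𝒜 q ∣             ∎
      where open ℕ.≤-Reasoning

    -- Since `β` is a minimum, `1 ≤ kβ` carries over to the ratio at every `𝒜`, in particular at the
    -- union of a tuple.
    κ≤k⇒k∣⁺∣+∣⁻∣≤kl : ∀ k → κ F t ℚ.≤ + k / 1 → ∀ 𝒜 →
      k * ∣ _⁺ F t 𝒜 ∣ + ∣ _⁻ F t 𝒜 ∣ ≤ k * l F t
    κ≤k⇒k∣⁺∣+∣⁻∣≤kl k κ≤k 𝒜 = 1≤kβ⇒k∣⁺∣+∣⁻∣≤kl k (β-view 𝒜)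
      (ℚ.≤-trans (κ≤q⇒1≤qβ (+ k / 1) κ≤k)
        (ℚ.*-monoˡ-≤-nonNeg (+ k / 1) {{ℚ.normalize-nonNeg k 1}} (β≤β-at 𝒜)))

    -- The upper bound `kβ < 1` says something about a particular sub-family only because the
    -- minimum `β` is attained.
    k<κ⇒kl<∑ : ∀ k (𝒜 : Fin (ℕ.suc k) → SubFamily F) → MaximumCrossIntersecting F t 𝒜 →
      + ℕ.suc k / 1 ℚ.< κ F t → ℕ.suc k * l F t < ∑[ p < ℕ.suc k ] ∣ 𝒜 p ∣
    k<κ⇒kl<∑ k 𝒜 maximum k<κ = kβ<1⇒kl<∑ k
      (subst (β-View (proj₁ β-attained)) (sym (proj₂ β-attained)) (β-view (proj₁ β-attained)))
      (q<κ⇒qβ<1 (+ ℕ.suc k / 1) k<κ) 𝒜 maximum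

theorem1p2 : (n t k : ℕ) → t ≥ 1 → k ≥ 1 →
    (F : Family n) .{{_ : NonZero (size F)}} → α F ≥ t →
    (𝒜 : Fin k → SubFamily F) → MaximumCrossIntersecting F t 𝒜 →
    (+ k / 1 ℚ.≥ κ F t → ∑[ i < k ] ∣ 𝒜 i ∣ ≡ k * l F t) ×
    (+ k / 1 ℚ.< κ F t → ∑[ i < k ] ∣ 𝒜 i ∣ > k * l F t)
theorem1p2 n t (ℕ.suc k) t≥1 k≥1 F α≥t 𝒜 maximum@(cross , _) =
  (λ κ≤k → ℕ.≤-antisym (upper κ≤k) lower) , k<κ⇒kl<∑ F t k 𝒜 maximum
  where
  upper : κ F t ℚ.≤ + ℕ.suc k / 1 → ∑[ i < ℕ.suc k ] ∣ 𝒜 i ∣ ≤ ℕ.suc k * l F t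
  upper κ≤k with 𝒰 , ∑≤ ← ∑≤k∣⋃⁺∣+∣⋃⁻∣ F t 𝒜 cross =
    ℕ.≤-trans ∑≤ (κ≤k⇒k∣⁺∣+∣⁻∣≤kl F t (ℕ.suc k) κ≤k 𝒰)

  lower : ℕ.suc k * l F t ≤ ∑[ i < ℕ.suc k ] ∣ 𝒜 i ∣
  -- A largest t-intersecting sub-family may consist of one set smaller than `t`, which cannot be
  -- repeated across slots; `ℒ` is at least as large and can be.
  lower with ℒ , l≤ , meets ← largest-meeting F t t≥1 α≥t =
    ℕ.≤-trans (ℕ.*-monoʳ-≤ (ℕ.suc k) l≤)
      (∷-replicate-≤ F t {X = ℒ} {Y = ℒ} {𝒜 = 𝒜} maximum id meets)
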